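{- Let $m\in\mathbb{N}$ with $m>2$. Each partition $\beta\in P_2(m)$ corresponds to a non-isomorphic $2$-regular bipartite graph with $2m$ vertices, i.e. there is a one-to-one correspondence between the elements of $P_2(m)$ and the isomorphism classes of $2$-regular bipartite graphs with $2m$ vertices. In particular, the number of pairwise non-isomorphic $2$-regular bipartite graphs with $2m$ vertices is precisely the number of elements of $P_2(m)$, that is, $E(m,2)=p(m,2)$.
   Context: A labeled $r$-regular bipartite graph with $2m$ vertices is a simple graph with vertex set the disjoint union of $CN=\{CN_1,\dots,CN_m\}$ and $VN=\{VN_1,\dots,VN_m\}$ and edge set $E\subset CN\times VN$ such that every vertex has degree $r$. Its bi-adjacency matrix is the $m\times m$ $0/1$ matrix with $(i,j)$ entry $1$ if and only if $(CN_i,VN_j)\in E$. Two such graphs are isomorphic if the bi-adjacency matrix of one can be transformed into that of the other by row exchanges and column exchanges. $E(m,r)$ denotes the number of isomorphism classes of $r$-regular bipartite graphs with $2m$ vertices. $P_2(m)$ is the set of (unordered) partitions of $m$ all of whose parts are natural numbers $\ge 2$, and $p(m,2)=|P_2(m)|$. -}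

module Defs where

open import Level using (0ℓ)
open import Data.Bool.Base using (Bool)
open import Data.Fin.Base using (Fin)
open import Data.Fin.Permutation.Components using (transpose; transpose-inverse)
open import Data.Fin.Subset using (Subset; ∣_∣)
open import Data.List.Base using (List; sum)
open import Data.List.Relation.Unary.All using (All)
open import Data.List.Relation.Binary.Permutation.Propositional using (↭-setoid)
open import Data.Nat.Base using (ℕ; _≤_)
open import Data.Vec.Base using (Vec; map; lookup; tabulate)
open import Data.Vec.Properties
  using (lookup∘tabulate; tabulate∘lookup; tabulate-cong; map-∘; map-cong; map-id)
open import Function.Base using (_∘_)
open import Function.Bundles using (Bijection)
open import Relation.Binary.Bundles using (Setoid)
open import Relation.Binary.Construct.Closure.ReflexiveTransitive
  using (Star; ε; _◅◅_; reverse)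
import Relation.Binary.Construct.On as On
open import Relation.Binary.PropositionalEquality
  using (_≡_; trans; cong; subst; setoid; module ≡-Reasoning)

-- The vertices CN₁, …, CNₘ and VN₁, …, VNₘ are two separate copies of Fin m, and
-- the edge set E ⊆ CN × VN is given by its characteristic function.
record RegularBipartiteGraph (m r : ℕ) : Set where
  field
    edge : Fin m → Fin m → Bool

  neighboursCN : Fin m → Subset m
  neighboursCN i = tabulate (λ j → edge i j)

  neighboursVN : Fin m → Subset m
  neighboursVN j = tabulate (λ i → edge i j)

  field
    degreeCN : ∀ i → ∣ neighboursCN i ∣ ≡ r
    degreeVN : ∀ j → ∣ neighboursVN j ∣ ≡ r

-- 0/1 matrices as vectors of rows, with false for 0 and true for 1.
Matrix : ℕ → Set
Matrix m = Vec (Vec Bool m) m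

biadjacency : ∀ {m r} → RegularBipartiteGraph m r → Matrix m
biadjacency G = tabulate (λ i → tabulate (λ j → edge i j))
  where open RegularBipartiteGraph G

exchange : ∀ {A : Set} {n} → Fin n → Fin n → Vec A n → Vec A n
exchange a b v = tabulate (λ k → lookup v (transpose a b k))

data _⟶_ {m : ℕ} : Matrix m → Matrix m → Set where
  rowExchange : ∀ a b M → M ⟶ exchange a b M
  colExchange : ∀ a b M → M ⟶ map (exchange a b) M

exchange-inverse : ∀ {A : Set} {n} (a b : Fin n) (v : Vec A n) →
                   exchange b a (exchange a b v) ≡ v
exchange-inverse a b v = trans
  (tabulate-cong λ k → trans
    (lookup∘tabulate _ (transpose b a k))
    (cong (lookup v) (transpose-inverse a b)))
  (tabulate∘lookup v)

⟶-sym : ∀ {m} {M N : Matrix m} → M ⟶ N → N ⟶ M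
⟶-sym (rowExchange a b M) =
  subst (exchange a b M ⟶_) (exchange-inverse a b M) (rowExchange b a _)
⟶-sym (colExchange a b M) =
  subst (map (exchange a b) M ⟶_) eq (colExchange b a _)
  where
  open ≡-Reasoning
  eq : map (exchange b a) (map (exchange a b) M) ≡ M
  eq = begin
    map (exchange b a) (map (exchange a b) M) ≡⟨ map-∘ _ _ M ⟨
    map (exchange b a ∘ exchange a b) M       ≡⟨ map-cong (exchange-inverse a b) M ⟩
    map (λ row → row) M                       ≡⟨ map-id M ⟩
    M                                         ∎

exchangeSetoid : ℕ → Setoid 0ℓ 0ℓ
exchangeSetoid m = record
  { Carrier       = Matrix m
  ; _≈_           = Star _⟶_
  ; isEquivalence = record
    { refl  = ε
    ; sym   = reverse ⟶-sym
    ; trans = _◅◅_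
    }
  }

-- Equality in this setoid is isomorphism of graphs, so that its elements are
-- the isomorphism classes.
IsoClasses : ℕ → ℕ → Setoid 0ℓ 0ℓ
IsoClasses m r = On.setoid (exchangeSetoid m) (biadjacency {m} {r})

record PartitionParts≥2 (m : ℕ) : Set where
  field
    parts    : List ℕ
    parts≥2  : All (2 ≤_) parts
    sumParts : sum parts ≡ m

-- Partitions are unordered: two lists of parts that are rearrangements of one
-- another are equal elements of P₂ m.
P₂ : ℕ → Setoid 0ℓ 0ℓ
P₂ m = On.setoid ↭-setoid (PartitionParts≥2.parts {m})

-- The setoid S has exactly n elements up to its equality.
HasCardinality : Setoid 0ℓ 0ℓ → ℕ → Set
HasCardinality S n = Bijection (setoid (Fin n)) S

-- Counts of classes are relations between the parameters and the number,
-- rather than functions: a setoid does not come with a count of its elements.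
E[_,_]≔_ : ℕ → ℕ → ℕ → Set
E[ m , r ]≔ n = HasCardinality (IsoClasses m r) n

p[_,2]≔_ : ℕ → ℕ → Set
p[ m ,2]≔ n = HasCardinality (P₂ m) n

{-# OPTIONS --safe #-}

-- An isomorphism of disjoint unions of cycles carries vertices that are connected to vertices that are
-- connected, so it permutes the cycles, and injectivity on each cycle forces equal lengths: this
-- recovers the partition from the graph. Conversely, in a 2-regular graph let σ and τ exchange the
-- two edges at a CN and at a VN. Iterating σ ∘ τ traverses a cycle, and σ reverses the direction. Since
-- σ and τ have no fixed points, the two directions never meet on the same edge, so after choosing one
-- edge on every cycle each CN, and each VN, is the endpoint of exactly one edge met on the traversals
-- that start from the chosen edges. The lengths of these traversals are the parts.

module Submission where

open import Defs
import Algebra.Properties.CommutativeMonoid.Sum as CommutativeMonoidSum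
open import Axiom.UniquenessOfIdentityProofs using (module Decidable⇒UIP)
open import Data.Bool.Base using (Bool; true; _∨_)
import Data.Bool.Properties as Bool
open import Data.Fin.Base using (Fin; zero; suc; toℕ; fromℕ; fromℕ<; inject₁; cast; combine)
open import Data.Fin.Induction using (<-weakInduction)
open import Data.Fin.Permutation as Perm using (Permutation; Permutation′; _⟨$⟩ʳ_; _⟨$⟩ˡ_; _∘ₚ_)
open import Data.Fin.Permutation.Transposition.List using (eval; decompose; eval-decompose)
import Data.Fin.Properties as Fin
open import Data.Fin.Relation.Unary.Top using (view; ‵fromℕ; ‵inject₁; view-fromℕ; view-inject₁)
open import Data.Fin.Subset using (Subset; ∣_∣; _∈_; _-_; _─_; Empty; Nonempty; inside; outside; ⊥; ⁅_⁆)
open import Data.Fin.Subset.Properties using (Empty-unique; ∣⊥∣≡0; nonempty?; p─q⊆p; x∈p∧x≢y⇒x∈p-y)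
open import Data.List.Base
  using (List; []; _∷_; [_]; length; lookup; tabulate; deduplicate; concatMap; cartesianProductWith; upTo)
import Data.List.Properties as List
open import Data.List.Membership.Propositional using () renaming (_∈_ to _∈ₗ_)
open import Data.List.Membership.Propositional.Properties
  using (∈-lookup; ∈-cartesianProductWith⁺; ∈-upTo⁺)
open import Data.List.Relation.Binary.Permutation.Homogeneous using (onIndices)
open import Data.List.Relation.Binary.Permutation.Propositional
  using (_↭_; ↭-refl; ↭-sym; ↭-trans; ↭-reflexive; ↭⇒↭ₛ)
open import Data.List.Relation.Binary.Permutation.Propositional.Properties using (++-commutativeMonoid)
open import Data.List.Relation.Binary.Permutation.Setoid.Properties using (onIndices-lookup)
open import Data.List.Relation.Binary.Pointwise using (Pointwise-≡⇒≡)
open import Data.List.Relation.Unary.All as All using (All; []; _∷_; all?)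
import Data.List.Relation.Unary.All.Properties as AllP
open import Data.List.Relation.Unary.AllPairs using (_∷_)
open import Data.List.Relation.Unary.Any as Any using (Any; here; there)
import Data.List.Relation.Unary.Any.Properties as AnyP
import Data.List.Relation.Unary.Enumerates.Setoid as Enumerates
open import Data.List.Relation.Unary.Enumerates.Setoid.Properties using (deduplicate⁺; lookup-surjective)
open import Data.List.Relation.Unary.Sorted.TotalOrder.Properties using (↗↭↗⇒≋)
open import Data.List.Relation.Unary.Unique.DecSetoid.Properties using (deduplicate-!)
import Data.List.Relation.Unary.Unique.Setoid as Unique
import Data.List.Sort as Sort
open import Data.Nat.Base using (ℕ; zero; suc; _+_; _≤_; _<_; z≤n; s≤s)
open import Data.Nat.ListAction using (sum)
import Data.Nat.Properties as ℕ
open import Data.Product.Base using (Σ; ∃; ∃₂; ∃-syntax; _×_; _,_; proj₁; proj₂; map₂)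
open import Data.Product.Function.Dependent.Propositional using (Σ-↔)
open import Data.Product.Properties using (,-injectiveʳ-UIP)
open import Data.Sum.Base as Sum using (_⊎_; inj₁; inj₂; [_,_]′)
open import Data.Sum.Function.Propositional using (_⊎-↔_)
open import Data.Vec.Base as Vec using (Vec; []; _∷_; here; there)
import Data.Vec.Properties as Vec
open import Function.Base using (_∘_)
open import Function.Bundles using (Bijection; Inverse; _↔_; mk↔ₛ′; mk⤖; mk⇔)
open import Function.Consequences.Propositional using (strictlySurjective⇒surjective)
open import Function.Construct.Composition using (_↔-∘_; bijection)
open import Function.Construct.Identity using (↔-id)
open import Function.Construct.Symmetry using (↔-sym)
open import Function.Properties.Bijection using (⤖⇒↔)
open import Level using (0ℓ)
open import Relation.Binary.Bundles using (Setoid; DecSetoid)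
open import Relation.Binary.Construct.Closure.ReflexiveTransitive using (Star; ε; _◅_; _◅◅_)
open import Relation.Binary.Definitions using (Decidable; DecidableEquality; tri<; tri≈; tri>)
open import Relation.Binary.PropositionalEquality hiding ([_])
open import Relation.Nullary using (¬_; Dec; yes; no; does; contradiction)
open import Relation.Nullary.Decidable using (map′; dec-true; _×-dec_; _⊎-dec_)

open RegularBipartiteGraph
open PartitionParts≥2

private variable
  A   : Set
  m n : ℕ
  p q : List ℕ

-- Isomorphism as a pair of permutations

lookup-ext : {u v : Vec A n} → (∀ i → Vec.lookup u i ≡ Vec.lookup v i) → u ≡ v
lookup-ext {u = u} {v} u≗v = trans (sym (Vec.tabulate∘lookup u)) (trans (Vec.tabulate-cong u≗v) (Vec.tabulate∘lookup v))

entry : Matrix m → Fin m → Fin m → Bool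
entry M i j = Vec.lookup (Vec.lookup M i) j

infix 4 _≅_

-- The permutations act on indices, so they pull entries of `M` back to `N` and compose in the order
-- opposite to the exchanges.
_≅_ : Matrix m → Matrix m → Set
_≅_ {m} M N = ∃₂ λ (ρ κ : Permutation′ m) → ∀ i j → entry M (ρ ⟨$⟩ʳ i) (κ ⟨$⟩ʳ j) ≡ entry N i j

≅-sym : (M N : Matrix m) → M ≅ N → N ≅ M
≅-sym M N (ρ , κ , eq) = Perm.flip ρ , Perm.flip κ , λ i j →
  trans (sym (eq _ _)) (cong₂ (entry M) (Perm.inverseʳ ρ) (Perm.inverseʳ κ))

⟶⇒≅ : {M N : Matrix m} → M ⟶ N → M ≅ N
⟶⇒≅ (rowExchange a b M) = Perm.transpose a b , Perm.id , λ i j →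
  sym (cong (λ row → Vec.lookup row j) (Vec.lookup∘tabulate _ i))
⟶⇒≅ (colExchange a b M) = Perm.id , Perm.transpose a b , λ i j →
  sym (trans (cong (λ row → Vec.lookup row j) (Vec.lookup-map i (exchange a b) M)) (Vec.lookup∘tabulate _ j))

⟶*⇒≅ : {M N : Matrix m} → Star _⟶_ M N → M ≅ N
⟶*⇒≅ ε = Perm.id , Perm.id , λ _ _ → refl
⟶*⇒≅ (s ◅ ss) with ⟶⇒≅ s | ⟶*⇒≅ ss
... | ρ , κ , eq | ρ′ , κ′ , eq′ = ρ′ ∘ₚ ρ , κ′ ∘ₚ κ , λ i j → trans (eq _ _) (eq′ i j)

rearrange : (Fin n → Fin n) → Vec A n → Vec A n
rearrange π v = Vec.tabulate (Vec.lookup v ∘ π)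

exchange-rearrange : ∀ (a b : Fin n) π (v : Vec A n) →
  exchange a b (rearrange π v) ≡ rearrange (π ∘ (Perm.transpose a b ⟨$⟩ʳ_)) v
exchange-rearrange a b π v = Vec.tabulate-cong λ k → Vec.lookup∘tabulate (Vec.lookup v ∘ π) (Perm.transpose a b ⟨$⟩ʳ k)

-- The permutation of `(a , b) ∷ xs` transposes before it applies `eval xs`. Since matrices are read
-- at permuted indices, the exchange of the head comes last.
⟶*-rows : ∀ xs (M : Matrix m) → Star _⟶_ M (rearrange (eval xs ⟨$⟩ʳ_) M)
⟶*-rows []             M = subst (Star _⟶_ M) (sym (Vec.tabulate∘lookup M)) ε
⟶*-rows ((a , b) ∷ xs) M = subst (Star _⟶_ M) (exchange-rearrange a b (eval xs ⟨$⟩ʳ_) M)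
  (⟶*-rows xs M ◅◅ rowExchange a b _ ◅ ε)

⟶*-cols : ∀ xs (M : Matrix m) → Star _⟶_ M (Vec.map (rearrange (eval xs ⟨$⟩ʳ_)) M)
⟶*-cols []             M = subst (Star _⟶_ M) (sym (trans (Vec.map-cong Vec.tabulate∘lookup M) (Vec.map-id M))) ε
⟶*-cols ((a , b) ∷ xs) M = subst (Star _⟶_ M)
  (trans (sym (Vec.map-∘ _ _ M)) (Vec.map-cong (exchange-rearrange a b (eval xs ⟨$⟩ʳ_)) M))
  (⟶*-cols xs M ◅◅ colExchange a b _ ◅ ε)

-- Every permutation is a product of transpositions. The rows are put in place first, then the
-- columns, which does not disturb the order of the rows.
≅⇒⟶* : {M N : Matrix m} → M ≅ N → Star _⟶_ M N
≅⇒⟶* {M = M} {N} (ρ , κ , eq) = subst (Star _⟶_ M) (lookup-ext λ i → lookup-ext λ j → entries i j)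
  (⟶*-rows (decompose ρ) M ◅◅ ⟶*-cols (decompose κ) _)
  where
  open ≡-Reasoning
  row col : Fin _ → Fin _
  row = eval (decompose ρ) ⟨$⟩ʳ_
  col = eval (decompose κ) ⟨$⟩ʳ_
  entries : ∀ i j → entry (Vec.map (rearrange col) (rearrange row M)) i j ≡ entry N i j
  entries i j = begin
    entry (Vec.map (rearrange col) (rearrange row M)) i j
      ≡⟨ cong (λ r → Vec.lookup r j) (Vec.lookup-map i _ (rearrange row M)) ⟩
    Vec.lookup (rearrange col (Vec.lookup (rearrange row M) i)) j
      ≡⟨ Vec.lookup∘tabulate _ j ⟩
    entry (rearrange row M) i (col j)
      ≡⟨ cong (λ r → Vec.lookup r (col j)) (Vec.lookup∘tabulate _ i) ⟩
    entry M (row i) (col j)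
      ≡⟨ cong₂ (entry M) (eval-decompose ρ i) (eval-decompose κ j) ⟩
    entry M (ρ ⟨$⟩ʳ i) (κ ⟨$⟩ʳ j)
      ≡⟨ eq i j ⟩
    entry N i j ∎

entry-biadjacency : ∀ {r} (G : RegularBipartiteGraph m r) i j →
  entry (biadjacency G) i j ≡ edge G i j
entry-biadjacency G i j = trans (cong (λ r → Vec.lookup r j) (Vec.lookup∘tabulate _ i)) (Vec.lookup∘tabulate _ j)

-- Subsets of size two

∣p∣≡1+∣p-x∣ : ∀ {p : Subset n} {x} → x ∈ p → ∣ p ∣ ≡ suc ∣ p - x ∣
∣p∣≡1+∣p-x∣ {p = inside ∷ p} here = cong (λ q → suc ∣ q ∣) (sym (─-⊥ p))
  where
  ─-⊥ : (q : Subset n) → q ─ ⊥ ≡ q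
  ─-⊥ []      = refl
  ─-⊥ (_ ∷ q) = cong (_ ∷_) (─-⊥ q)
∣p∣≡1+∣p-x∣ {p = inside  ∷ p} (there x∈p) = cong suc (∣p∣≡1+∣p-x∣ x∈p)
∣p∣≡1+∣p-x∣ {p = outside ∷ p} (there x∈p) = ∣p∣≡1+∣p-x∣ x∈p

Empty⇒∣p∣≡0 : {p : Subset n} → Empty p → ∣ p ∣ ≡ 0
Empty⇒∣p∣≡0 {n} empty = trans (cong ∣_∣ (Empty-unique empty)) (∣⊥∣≡0 n)

∣p∣≡0⇒Empty : {p : Subset n} → ∣ p ∣ ≡ 0 → Empty p
∣p∣≡0⇒Empty eq (x , x∈p) with () ← trans (sym eq) (∣p∣≡1+∣p-x∣ x∈p)

y∈p-x⇒y≢x : ∀ {p : Subset n} {x y} → y ∈ p - x → y ≢ x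
y∈p-x⇒y≢x {p = _ ∷ p} {zero}  (there y∈) ()
y∈p-x⇒y≢x {p = _ ∷ p} {suc x} (there y∈) refl = y∈p-x⇒y≢x {p = p} y∈ refl

y∈p-x⇒y∈p : ∀ {p : Subset n} {x y} → y ∈ p - x → y ∈ p
y∈p-x⇒y∈p {p = p} {x} = p─q⊆p p ⁅ x ⁆

∣p∣≡2 : ∀ {p : Subset n} {a b} → a ≢ b → a ∈ p → b ∈ p → (∀ {k} → k ∈ p → k ≡ a ⊎ k ≡ b) → ∣ p ∣ ≡ 2
∣p∣≡2 {p = p} {a} {b} a≢b a∈p b∈p only = trans (∣p∣≡1+∣p-x∣ a∈p) (cong suc
  (trans (∣p∣≡1+∣p-x∣ (x∈p∧x≢y⇒x∈p-y b∈p (≢-sym a≢b))) (cong suc (Empty⇒∣p∣≡0 empty))))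
  where
  empty : Empty (p - a - b)
  empty (k , k∈) with only (y∈p-x⇒y∈p {p = p} (y∈p-x⇒y∈p {p = p - a} k∈))
  ... | inj₁ k≡a = y∈p-x⇒y≢x {p = p} (y∈p-x⇒y∈p {p = p - a} k∈) k≡a
  ... | inj₂ k≡b = y∈p-x⇒y≢x {p = p - a} k∈ k≡b

∣p∣≡1+k⇒Nonempty : ∀ {p : Subset n} {k} → ∣ p ∣ ≡ suc k → Nonempty p
∣p∣≡1+k⇒Nonempty {p = p} eq with nonempty? p
... | yes ne = ne
... | no empty with () ← trans (sym eq) (Empty⇒∣p∣≡0 empty)

-- With `a` removed one element `b` remains, and a third element would survive in `p - a - b`, which
-- is empty. This later supplies the other edge at a vertex.
∣p∣≡2⇒partner : ∀ {p : Subset n} {a} → ∣ p ∣ ≡ 2 → a ∈ p →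
  ∃ λ b → b ∈ p × b ≢ a × (∀ {k} → k ∈ p → k ≡ a ⊎ k ≡ b)
∣p∣≡2⇒partner {p = p} {a} eq a∈p = b , y∈p-x⇒y∈p {p = p} b∈ , y∈p-x⇒y≢x {p = p} b∈ , only
  where
  one : ∣ p - a ∣ ≡ 1
  one = ℕ.suc-injective (trans (sym (∣p∣≡1+∣p-x∣ a∈p)) eq)
  b = proj₁ (∣p∣≡1+k⇒Nonempty one)
  b∈ = proj₂ (∣p∣≡1+k⇒Nonempty one)
  only : ∀ {k} → k ∈ p → k ≡ a ⊎ k ≡ b
  only {k} k∈p with k Fin.≟ a | k Fin.≟ b
  ... | yes k≡a | _ = inj₁ k≡a
  ... | no _ | yes k≡b = inj₂ k≡b
  ... | no k≢a | no k≢b = contradiction (k , x∈p∧x≢y⇒x∈p-y (x∈p∧x≢y⇒x∈p-y k∈p k≢a) k≢b)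
    (∣p∣≡0⇒Empty (ℕ.suc-injective (trans (sym (∣p∣≡1+∣p-x∣ b∈)) one)))

∈-tabulate⁺ : {f : Fin n → Bool} → ∀ {i} → f i ≡ true → i ∈ Vec.tabulate f
∈-tabulate⁺ {f = f} {i} eq = Vec.lookup⇒[]= i _ (trans (Vec.lookup∘tabulate f i) eq)

∈-tabulate⁻ : {f : Fin n → Bool} → ∀ {i} → i ∈ Vec.tabulate f → f i ≡ true
∈-tabulate⁻ {f = f} {i} i∈ = trans (sym (Vec.lookup∘tabulate f i)) (Vec.[]=⇒lookup i∈)

from-to : {A B : Set} (e : A ↔ B) (x : A) → Inverse.from e (Inverse.to e x) ≡ x
from-to = Inverse.strictlyInverseʳ

to-from : {A B : Set} (e : A ↔ B) (y : B) → Inverse.to e (Inverse.from e y) ≡ y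
to-from = Inverse.strictlyInverseˡ

to-injective : {A B : Set} (e : A ↔ B) {x y : A} → Inverse.to e x ≡ Inverse.to e y → x ≡ y
to-injective e eq = trans (sym (from-to e _)) (trans (cong (Inverse.from e) eq) (from-to e _))

-- Graphs of fixed-point-free permutations

module PermutationGraph (π : Permutation′ m) (noFix : ∀ i → π ⟨$⟩ʳ i ≢ i) where

  adjacent : Fin m → Fin m → Bool
  adjacent i j = does (j Fin.≟ i) ∨ does (j Fin.≟ π ⟨$⟩ʳ i)

  adjacent⁻ : ∀ i j → adjacent i j ≡ true → j ≡ i ⊎ j ≡ π ⟨$⟩ʳ i
  adjacent⁻ i j eq with j Fin.≟ i | j Fin.≟ π ⟨$⟩ʳ i
  ... | yes j≡i | _       = inj₁ j≡i
  ... | no _    | yes j≡π = inj₂ j≡π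

  adjacent⁺ : ∀ i j → j ≡ i ⊎ j ≡ π ⟨$⟩ʳ i → adjacent i j ≡ true
  adjacent⁺ i j (inj₁ j≡i) = cong (_∨ does (j Fin.≟ π ⟨$⟩ʳ i)) (dec-true (j Fin.≟ i) j≡i)
  adjacent⁺ i j (inj₂ j≡π) = trans (cong (does (j Fin.≟ i) ∨_) (dec-true (j Fin.≟ π ⟨$⟩ʳ i) j≡π)) (Bool.∨-zeroʳ _)

  -- Without fixed points the two neighbours of every vertex are distinct. A 2-cycle of `π` gives no
  -- double edge, because CN and VN are separate copies: it becomes a cycle on four vertices.
  permutationGraph : RegularBipartiteGraph m 2
  permutationGraph .edge = adjacent
  permutationGraph .degreeCN i = ∣p∣≡2 (≢-sym (noFix i))
    (∈-tabulate⁺ (adjacent⁺ i i (inj₁ refl))) (∈-tabulate⁺ (adjacent⁺ i _ (inj₂ refl)))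
    (adjacent⁻ _ _ ∘ ∈-tabulate⁻)
  permutationGraph .degreeVN j = ∣p∣≡2 {a = j} {b = π ⟨$⟩ˡ j}
    (λ j≡ → noFix j (trans (cong (π ⟨$⟩ʳ_) j≡) (Perm.inverseʳ π)))
    (∈-tabulate⁺ (adjacent⁺ j j (inj₁ refl))) (∈-tabulate⁺ (adjacent⁺ _ j (inj₂ (sym (Perm.inverseʳ π)))))
    (λ k∈ → Sum.map sym (λ j≡πk → trans (sym (Perm.inverseˡ π)) (cong (π ⟨$⟩ˡ_) (sym j≡πk)))
                  (adjacent⁻ _ _ (∈-tabulate⁻ k∈)))

open PermutationGraph using (permutationGraph; adjacent⁺; adjacent⁻)

-- Disjoint unions of cycles

prev : Fin n → Fin n
prev zero    = fromℕ _
prev (suc i) = inject₁ i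

next : Fin n → Fin n
next i with view i
... | ‵fromℕ     = zero
... | ‵inject₁ k = suc k

rotation : Fin n ↔ Fin n
rotation = mk↔ₛ′ prev next prev-next next-prev
  where
  prev-next : (i : Fin n) → prev (next i) ≡ i
  prev-next i with view i
  ... | ‵fromℕ     = refl
  ... | ‵inject₁ _ = refl
  next-prev : (i : Fin n) → next (prev i) ≡ i
  next-prev {suc n} zero    rewrite view-fromℕ n   = refl
  next-prev         (suc i) rewrite view-inject₁ i = refl

prev≢ : 2 ≤ n → (i : Fin n) → prev i ≢ i
prev≢ (s≤s (s≤s z≤n)) zero ()
prev≢ _ (suc i) eq = ℕ.1+n≢n (trans (cong toℕ (sym eq)) (Fin.toℕ-inject₁ i))

prev-cast : (eq : m ≡ n) (i : Fin m) → cast eq (prev i) ≡ prev (cast eq i)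
prev-cast refl i = trans (Fin.cast-is-id refl _) (cong prev (sym (Fin.cast-is-id refl i)))

-- All positions lie on a single cycle of `prev`, so each value can be carried down step by step to
-- `zero`.
prev-invariant⇒constant : (g : Fin n → A) → (∀ i → g (prev i) ≡ g i) → ∀ i j → g i ≡ g j
prev-invariant⇒constant {n = suc n} g inv i j = trans (const i) (sym (const j))
  where
  const : ∀ i → g i ≡ g zero
  const = <-weakInduction (λ i → g i ≡ g zero) refl (λ i eq → trans (sym (inv (suc i))) eq)

-- The boxes of the diagram with row lengths `p`. A record, unlike a Σ-type over `length p` and
-- `lookup p`, lets `p` be inferred from the type of a cell.
record Cell (p : List ℕ) : Set where
  constructor _,_
  field
    block    : Fin (length p)
    position : Fin (lookup p block)

open Cell

Cell↔Σ : ∀ p → Cell p ↔ Σ (Fin (length p)) (Fin ∘ lookup p)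
Cell↔Σ p = mk↔ₛ′ (λ (i , j) → i , j) (λ (i , j) → i , j) (λ _ → refl) (λ _ → refl)

Cell-injectiveʳ : ∀ {i j k} → _≡_ {A = Cell p} (i , j) (i , k) → j ≡ k
Cell-injectiveʳ {p} eq = ,-injectiveʳ-UIP (Decidable⇒UIP.≡-irrelevant Fin._≟_) (cong (Inverse.to (Cell↔Σ p)) eq)

Cell-∷ : ∀ k p → Cell (k ∷ p) ↔ (Fin k ⊎ Cell p)
Cell-∷ k p = mk↔ₛ′
  (λ { (zero , j) → inj₁ j ; (suc i , j) → inj₂ (i , j) })
  (λ { (inj₁ j) → zero , j ; (inj₂ (i , j)) → suc i , j })
  (λ { (inj₁ j) → refl ; (inj₂ (i , j)) → refl })
  (λ { (zero , j) → refl ; (suc i , j) → refl })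

Cell↔Fin : ∀ p → Cell p ↔ Fin (sum p)
Cell↔Fin []      = mk↔ₛ′ (λ ()) (λ ()) (λ ()) (λ ())
Cell↔Fin (k ∷ p) = ↔-sym Fin.+↔⊎ ↔-∘ ((↔-id _ ⊎-↔ Cell↔Fin p) ↔-∘ Cell-∷ k p)

prevCell : Cell p → Cell p
prevCell (i , j) = i , prev j

cellRotation : Cell p ↔ Cell p
cellRotation = mk↔ₛ′ prevCell (λ (i , j) → i , next j)
  (λ (i , j) → cong (i ,_) (to-from rotation j)) (λ (i , j) → cong (i ,_) (from-to rotation j))

prevCell≢ : All (2 ≤_) p → (x : Cell p) → prevCell x ≢ x
prevCell≢ {p} p≥2 (i , j) eq = prev≢ (All.lookup p≥2 (∈-lookup i)) j (Cell-injectiveʳ eq)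

module _ (σ : Permutation (length p) (length q))
         (same-size : ∀ i → lookup p i ≡ lookup q (σ ⟨$⟩ʳ i)) where

  relabelBlocks : Cell p ↔ Cell q
  relabelBlocks = ↔-sym (Cell↔Σ q) ↔-∘ (Σ-↔ σ (λ {i} → Perm.cast-id (same-size i)) ↔-∘ Cell↔Σ p)

  relabelBlocks-prev : ∀ x → Inverse.to relabelBlocks (prevCell x) ≡ prevCell (Inverse.to relabelBlocks x)
  relabelBlocks-prev (i , j) = cong (_ ,_) (prev-cast (same-size i) j)

-- Up to ↭ a list is the product of its singletons in a commutative monoid, and such a product
-- does not change when its index set is permuted.
same-blocks⇒↭ : (σ : Permutation (length p) (length q)) →
                (∀ i → lookup p i ≡ lookup q (σ ⟨$⟩ʳ i)) → p ↭ q
same-blocks⇒↭ {p} {q} σ same-size =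
  ↭-trans (↭-reflexive (sym (flatten p)))
  (↭-trans (↭-reflexive (sum-cong-≗ (cong [_] ∘ same-size)))
  (↭-trans (↭-sym (sum-permute ([_] ∘ lookup q) σ)) (↭-reflexive (flatten q))))
  where
  open CommutativeMonoidSum (++-commutativeMonoid {A = ℕ}) renaming (sum to concatAll)
  flatten : ∀ xs → concatAll ([_] ∘ lookup xs) ≡ xs
  flatten []       = refl
  flatten (x ∷ xs) = cong (x ∷_) (flatten xs)

-- Transport along `same` moves all images into one fixed block, where positions alone tell them
-- apart.
≤-size : ∀ {n} {i : Fin (length q)} (f : Fin n → Cell q) → (∀ {j k} → f j ≡ f k → j ≡ k) →
         (∀ j → block (f j) ≡ i) → n ≤ lookup q i
≤-size {q = q} {i = i} f f-inj same = Fin.injective⇒≤ {f = λ j → subst (Fin ∘ lookup q) (same j) (position (f j))}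
  (λ {j} {k} eq → f-inj (merge (same j) (same k) eq))
  where
  merge : ∀ {x y : Cell q} (eq₁ : block x ≡ i) (eq₂ : block y ≡ i) →
          subst (Fin ∘ lookup q) eq₁ (position x) ≡ subst (Fin ∘ lookup q) eq₂ (position y) → x ≡ y
  merge refl refl refl = refl

-- The bijection is not asked to commute with `prevCell`, since a graph isomorphism may reverse a
-- cycle. Preserving blocks in both directions is enough: a block then has a well-defined image
-- block, and injectivity both ways makes the sizes equal.
module BlockPreserving (p≥2 : All (2 ≤_) p) (q≥2 : All (2 ≤_) q) (e : Cell p ↔ Cell q)
  (to-block   : ∀ x → block (Inverse.to e (prevCell x)) ≡ block (Inverse.to e x))
  (from-block : ∀ y → block (Inverse.from e (prevCell y)) ≡ block (Inverse.from e y)) where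

  open Inverse e using (to; from)

  first : ∀ {p} → All (2 ≤_) p → (i : Fin (length p)) → Fin (lookup p i)
  first p≥2 i = fromℕ< {0} (ℕ.≤-trans (s≤s z≤n) (All.lookup p≥2 (∈-lookup i)))

  to-const : ∀ i j j′ → block (to (i , j)) ≡ block (to (i , j′))
  to-const i = prev-invariant⇒constant (λ j → block (to (i , j))) (λ j → to-block (i , j))

  from-const : ∀ i j j′ → block (from (i , j)) ≡ block (from (i , j′))
  from-const i = prev-invariant⇒constant (λ j → block (from (i , j))) (λ j → from-block (i , j))

  toBlock : Fin (length p) → Fin (length q)
  toBlock i = block (to (i , first p≥2 i))

  fromBlock : Fin (length q) → Fin (length p)
  fromBlock i = block (from (i , first q≥2 i))

  blocks : Permutation (length p) (length q)
  blocks = mk↔ₛ′ toBlock fromBlock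
    (λ i → trans (to-const _ _ _) (cong block (to-from e (i , first q≥2 i))))
    (λ i → trans (from-const _ _ _) (cong block (from-to e (i , first p≥2 i))))

  same-size : ∀ i → lookup p i ≡ lookup q (blocks ⟨$⟩ʳ i)
  same-size i = ℕ.≤-antisym
    (≤-size (λ j → to (i , j)) (λ eq → Cell-injectiveʳ (to-injective e eq)) (λ j → to-const i _ _))
    (≤-size (λ j → from (toBlock i , j)) (λ eq → Cell-injectiveʳ (to-injective (↔-sym e) eq))
      (λ j → trans (from-const _ _ _) (from-to blocks i)))

  p↭q : p ↭ q
  p↭q = same-blocks⇒↭ blocks same-size

-- Cycle graphs of partitions and their isomorphisms

cellIndex : (P : PartitionParts≥2 m) → Cell (parts P) ↔ Fin m
cellIndex P = subst (λ k → Cell (parts P) ↔ Fin k) (sumParts P) (Cell↔Fin (parts P))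

cyclePermutation : PartitionParts≥2 m → Permutation′ m
cyclePermutation P = cellIndex P ↔-∘ (cellRotation ↔-∘ ↔-sym (cellIndex P))

cyclePermutation≢ : (P : PartitionParts≥2 m) → ∀ i → cyclePermutation P ⟨$⟩ʳ i ≢ i
cyclePermutation≢ P i eq = prevCell≢ (parts≥2 P) (Inverse.from (cellIndex P) i)
  (trans (sym (from-to (cellIndex P) _)) (cong (Inverse.from (cellIndex P)) eq))

-- A cell stands for one CN and one VN, and the CN of a cell x is joined to the VNs of x and of prevCell x.
cycleGraph : PartitionParts≥2 m → RegularBipartiteGraph m 2
cycleGraph P = permutationGraph (cyclePermutation P) (cyclePermutation≢ P)

bool-ext : {b c : Bool} → (b ≡ true → c ≡ true) → (c ≡ true → b ≡ true) → b ≡ c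
bool-ext f g = Bool.⇔→≡ (mk⇔ f g)

-- A rearrangement of the parts moves whole blocks and commutes with `prevCell`. The induced `κ`
-- therefore conjugates one cycle permutation into the other, and serves for rows and columns alike.
↭⇒≅ : (P Q : PartitionParts≥2 m) → parts P ↭ parts Q →
      biadjacency (cycleGraph P) ≅ biadjacency (cycleGraph Q)
↭⇒≅ {m} P Q P↭Q = ≅-sym (biadjacency (cycleGraph Q)) (biadjacency (cycleGraph P)) (κ , κ , λ i j →
  trans (entry-biadjacency (cycleGraph Q) _ _)
  (trans (bool-ext
    (λ adj → adjacent⁺ π (cyclePermutation≢ P) _ _
       (Sum.map (to-injective κ) (λ eq → to-injective κ (trans eq (sym (κ-conj i))))
              (adjacent⁻ π′ (cyclePermutation≢ Q) _ _ adj)))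
    (λ adj → adjacent⁺ π′ (cyclePermutation≢ Q) _ _
       (Sum.map (cong (κ ⟨$⟩ʳ_)) (λ eq → trans (cong (κ ⟨$⟩ʳ_) eq) (κ-conj i))
              (adjacent⁻ π (cyclePermutation≢ P) i j adj))))
  (sym (entry-biadjacency (cycleGraph P) i j))))
  where
  π = cyclePermutation P
  π′ = cyclePermutation Q
  φ : Cell (parts P) ↔ Cell (parts Q)
  φ = relabelBlocks {parts P} {parts Q} (onIndices (↭⇒↭ₛ P↭Q)) (onIndices-lookup (setoid ℕ) (↭⇒↭ₛ P↭Q))
  κ : Permutation′ m
  κ = cellIndex Q ↔-∘ (φ ↔-∘ ↔-sym (cellIndex P))
  κ-conj : ∀ i → κ ⟨$⟩ʳ (π ⟨$⟩ʳ i) ≡ π′ ⟨$⟩ʳ (κ ⟨$⟩ʳ i)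
  κ-conj i = cong (Inverse.to (cellIndex Q)) (trans
    (cong (Inverse.to φ) (from-to (cellIndex P) _))
    (trans (relabelBlocks-prev {parts P} {parts Q} (onIndices (↭⇒↭ₛ P↭Q)) (onIndices-lookup (setoid ℕ) (↭⇒↭ₛ P↭Q)) _)
      (cong prevCell (sym (from-to (cellIndex Q) _)))))

module _ (P Q : PartitionParts≥2 m) (ρ κ : Permutation′ m)
  (iso : ∀ i j → entry (biadjacency (cycleGraph Q)) (ρ ⟨$⟩ʳ i) (κ ⟨$⟩ʳ j) ≡ entry (biadjacency (cycleGraph P)) i j)
  where

  private
    π = cyclePermutation P
    π′ = cyclePermutation Q

    blockOf : Fin m → Fin (length (parts Q))
    blockOf j = block (Inverse.from (cellIndex Q) j)

    blockOf-π : ∀ j → blockOf (π′ ⟨$⟩ʳ j) ≡ blockOf j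
    blockOf-π j = cong block (from-to (cellIndex Q) _)

    blockOf-adjacent : ∀ {i j} → j ≡ i ⊎ j ≡ π ⟨$⟩ʳ i → blockOf (κ ⟨$⟩ʳ j) ≡ blockOf (ρ ⟨$⟩ʳ i)
    blockOf-adjacent {i} {j} adj with adjacent⁻ π′ (cyclePermutation≢ Q) _ _
      (trans (sym (entry-biadjacency (cycleGraph Q) _ _)) (trans (iso i j)
        (trans (entry-biadjacency (cycleGraph P) i j) (adjacent⁺ π (cyclePermutation≢ P) i j adj))))
    ... | inj₁ eq = cong blockOf eq
    ... | inj₂ eq = trans (cong blockOf eq) (blockOf-π _)

  -- The CNs of `x` and of `prevCell x` have the VN of `prevCell x` as a common neighbour, and
  -- adjacent vertices have images in the same block.
  blockOf-invariant : ∀ x → blockOf (ρ ⟨$⟩ʳ Inverse.to (cellIndex P) (prevCell x)) ≡ blockOf (ρ ⟨$⟩ʳ Inverse.to (cellIndex P) x)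
  blockOf-invariant x = trans (sym (blockOf-adjacent (inj₁ refl)))
    (blockOf-adjacent (inj₂ (cong (Inverse.to (cellIndex P) ∘ prevCell) (sym (from-to (cellIndex P) x)))))

-- The row permutation serves as the bijection of cells. The column permutation enters only in
-- showing that blocks are preserved, once for the isomorphism and once for its inverse.
≅⇒↭ : (P Q : PartitionParts≥2 m) → biadjacency (cycleGraph Q) ≅ biadjacency (cycleGraph P) →
      parts P ↭ parts Q
≅⇒↭ P Q Q≅P@(ρ , κ , iso) = ↭-sym (BlockPreserving.p↭q (parts≥2 Q) (parts≥2 P)
  (↔-sym (cellIndex P) ↔-∘ (Perm.flip ρ ↔-∘ cellIndex Q))
  (blockOf-invariant Q P (Perm.flip ρ) (Perm.flip κ)
     (proj₂ (proj₂ (≅-sym (biadjacency (cycleGraph Q)) (biadjacency (cycleGraph P)) Q≅P))))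
  (blockOf-invariant P Q ρ κ iso))

-- Cardinality up to a decidable equivalence

module _ (S : DecSetoid 0ℓ 0ℓ) where
  open DecSetoid S using (_≈_; _≟_) renaming (setoid to S′; sym to ≈-sym)
  open Unique S′ using (Unique)
  open Enumerates S′ using (IsEnumeration)

  Unique⇒lookup-injective : ∀ {xs} → Unique xs → ∀ {i j} → lookup xs i ≈ lookup xs j → i ≡ j
  Unique⇒lookup-injective (_  ∷ _)  {zero}  {zero}  _  = refl
  Unique⇒lookup-injective (x∉ ∷ _)  {zero}  {suc j} eq = contradiction eq (All.lookup x∉ (∈-lookup j))
  Unique⇒lookup-injective (x∉ ∷ _)  {suc i} {zero}  eq = contradiction (≈-sym eq) (All.lookup x∉ (∈-lookup i))
  Unique⇒lookup-injective (_  ∷ u)  {suc i} {suc j} eq = cong suc (Unique⇒lookup-injective u eq)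

  -- In the deduplicated list no two entries are equivalent, so its indices are injective; every
  -- element is still equivalent to some entry.
  enumeration⇒cardinality : ∀ {xs} → IsEnumeration xs → ∃ λ n → Bijection (setoid (Fin n)) S′
  enumeration⇒cardinality {xs} enum = length (deduplicate _≟_ xs) , record
    { to        = lookup (deduplicate _≟_ xs)
    ; cong      = λ { refl → DecSetoid.refl S }
    ; bijective = Unique⇒lookup-injective (deduplicate-! S xs) , lookup-surjective S′ (deduplicate⁺ S enum)
    }

-- Traversing the cycles of a 2-regular graph

least : {P : ℕ → Set} → (∀ k → Dec (P k)) → ∀ n → P n → ∃ λ k → P k × (∀ {j} → j < k → ¬ P j)
least P? zero    p = zero , p , λ ()
least P? (suc n) p with P? zero
... | yes p₀ = zero , p₀ , λ ()
... | no ¬p₀ with least (P? ∘ suc) n p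
...   | k , pk , below = suc k , pk , λ { {zero} _ → ¬p₀ ; {suc j} (s≤s j<k) → below j<k }

module Iteration {E : Set} (f : E → E) where

  iter : ℕ → E → E
  iter zero    x = x
  iter (suc k) x = f (iter k x)

  iter-+ : ∀ a b x → iter (a + b) x ≡ iter a (iter b x)
  iter-+ zero    b x = refl
  iter-+ (suc a) b x = cong f (iter-+ a b x)

  iter-suc : ∀ k x → iter (suc k) x ≡ iter k (f x)
  iter-suc zero    x = refl
  iter-suc (suc k) x = cong f (iter-suc k x)

  Reach : E → E → Set
  Reach x y = ∃ λ k → iter k x ≡ y

  reach-trans : ∀ {x y z} → Reach x y → Reach y z → Reach x z
  reach-trans {x} (k , refl) (l , refl) = l + k , iter-+ l k x

  iter-prev : ∀ {n x} → iter n x ≡ x → (j : Fin n) → iter (toℕ j) x ≡ f (iter (toℕ (prev j)) x)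
  iter-prev {suc n} {x} ret zero = trans (sym ret) (cong (λ k → iter (suc k) x) (sym (Fin.toℕ-fromℕ n)))
  iter-prev {x = x} ret (suc j)  = cong (λ k → iter (suc k) x) (sym (Fin.toℕ-inject₁ j))

module Orbits {E : Set} (_≟_ : DecidableEquality E) {N} (code : E → Fin N)
  (code-injective : ∀ {x y} → code x ≡ code y → x ≡ y)
  (f : E → E) (f-injective : ∀ {x y} → f x ≡ f y → x ≡ y) where

  open Iteration f

  iter-injective : ∀ k {x y} → iter k x ≡ iter k y → x ≡ y
  iter-injective zero    eq = eq
  iter-injective (suc k) eq = iter-injective k (f-injective eq)

  -- The first `a` steps can be cancelled because `f` is injective, which leaves a return after the
  -- remaining steps.
  returns : ∀ a b {x} → a < b → iter a x ≡ iter b x → ∃ λ k → suc k + a ≡ b × iter (suc k) x ≡ x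
  returns a b {x} a<b eq with ℕ.m≤n⇒∃[o]m+o≡n a<b
  ... | k , refl = k , cong suc (ℕ.+-comm k a) , iter-injective a
    (trans (sym (iter-+ a (suc k) x)) (trans (cong (λ l → iter l x) (ℕ.+-suc a k)) (sym eq)))

  recurrent : ∀ x → ∃ λ k → iter (suc k) x ≡ x
  -- Among the `suc N` iterates with exponents 0 to `N`, two have the same code in `Fin N`.
  recurrent x with Fin.pigeonhole (ℕ.≤-refl {suc N}) (λ i → code (iter (toℕ i) x))
  ... | i , j , i<j , eq = map₂ proj₂ (returns (toℕ i) (toℕ j) i<j (code-injective eq))

  abstract
    firstReturn : ∀ x → ∃ λ k → iter (suc k) x ≡ x × (∀ {j} → j < k → iter (suc j) x ≢ x)
    firstReturn x = least (λ k → iter (suc k) x ≟ x) (proj₁ (recurrent x)) (proj₂ (recurrent x))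

  order : E → ℕ
  order x = suc (proj₁ (firstReturn x))

  iter-order : ∀ x → iter (order x) x ≡ x
  iter-order x = proj₁ (proj₂ (firstReturn x))

  order≥2 : ∀ x → f x ≢ x → 2 ≤ order x
  order≥2 x fx≢x with firstReturn x
  ... | zero  , fx≡x , _ = contradiction fx≡x fx≢x
  ... | suc _ , _        = s≤s (s≤s z≤n)

  iter-≢ : ∀ {a b x} → a < b → b < order x → iter a x ≢ iter b x
  iter-≢ {a} {b} {x} a<b (s≤s b≤) eq with returns a b a<b eq
  ... | k , refl , ret = proj₂ (proj₂ (firstReturn x)) (ℕ.≤-trans (s≤s (ℕ.m≤m+n k a)) b≤) ret

  iter<order-injective : ∀ {a b x} → a < order x → b < order x → iter a x ≡ iter b x → a ≡ b
  iter<order-injective {a} {b} a< b< eq with ℕ.<-cmp a b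
  ... | tri≈ _ a≡b _ = a≡b
  ... | tri< a<b _ _ = contradiction eq (iter-≢ a<b b<)
  ... | tri> _ _ b<a = contradiction (sym eq) (iter-≢ b<a a<)

  -- A single step is undone by going round the rest of the cycle, which exists by `recurrent`.
  reach-sym : ∀ {x y} → Reach x y → Reach y x
  reach-sym {x} (zero  , refl) = zero , refl
  reach-sym {x} (suc k , refl) = reach-trans (back (iter k x)) (reach-sym (k , refl))
    where
    back : ∀ z → Reach (f z) z
    back z = proj₁ (recurrent z) , trans (sym (iter-suc (proj₁ (recurrent z)) z)) (proj₂ (recurrent z))

  reach-bounded : ∀ {x y} → Reach x y → ∃ λ (j : Fin (order x)) → iter (toℕ j) x ≡ y
  reach-bounded (zero  , eq)   = zero , eq
  reach-bounded {x} (suc k , refl) with reach-bounded {x} (k , refl)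
  ... | j , eq with ℕ.m≤n⇒m<n∨m≡n (Fin.toℕ<n j)
  ...   | inj₁ j<  = fromℕ< j< , trans (cong (λ l → iter l x) (Fin.toℕ-fromℕ< j<)) (cong f eq)
  -- At the last position the next step closes the cycle, so the index wraps to `zero`.
  ...   | inj₂ j≡ = zero , trans (sym (iter-order x)) (trans (cong (λ l → iter l x) (sym j≡)) (cong f eq))

  reach? : Decidable Reach
  reach? x y = map′ (λ (j , eq) → toℕ j , eq) reach-bounded (Fin.any? λ j → iter (toℕ j) x ≟ y)

-- Regularity of degree 2 seen from the edges: each inhabited fibre of `key`, the end of an edge on
-- one side, is a pair that `partner` swaps.
record Pairing {E I : Set} (key : E → I) : Set where
  field
    partner     : E → E
    key-partner : ∀ x → key (partner x) ≡ key x
    partner≢    : ∀ x → partner x ≢ x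
    same-key    : ∀ {x y} → key x ≡ key y → y ≡ x ⊎ y ≡ partner x

  involutive : ∀ x → partner (partner x) ≡ x
  involutive x with same-key {x} {partner (partner x)} (sym (trans (key-partner _) (key-partner x)))
  ... | inj₁ eq = eq
  ... | inj₂ eq = contradiction eq (partner≢ (partner x))

  partner-injective : ∀ {x y} → partner x ≡ partner y → x ≡ y
  partner-injective eq = trans (sym (involutive _)) (trans (cong partner eq) (involutive _))

-- Unlike the lemma of the same name in Data.List.Properties, this one casts on the right-hand side.
lookup-tabulate : ∀ {A : Set} (g : Fin n → A) i → lookup (tabulate g) i ≡ g (cast (List.length-tabulate g) i)
lookup-tabulate {n = suc n} g zero    = refl
lookup-tabulate {n = suc n} g (suc i) = lookup-tabulate (g ∘ suc) i

-- Both sides are numbered by the cells of one partition so that incidence follows the rule of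
-- `cycleGraph`.
record Decomposition {E : Set} {m} (row col : E → Fin m) : Set where
  field
    cycles   : PartitionParts≥2 m
    rowIndex : Cell (parts cycles) ↔ Fin m
    colIndex : Cell (parts cycles) ↔ Fin m
    incident⇒consecutive : ∀ e {x y} → row e ≡ Inverse.to rowIndex x → col e ≡ Inverse.to colIndex y →
                           y ≡ x ⊎ y ≡ prevCell x
    consecutive⇒incident : ∀ {x y} → y ≡ x ⊎ y ≡ prevCell x →
                           ∃ λ e → row e ≡ Inverse.to rowIndex x × col e ≡ Inverse.to colIndex y

module CycleDecomposition {E : Set} {m} (row col : E → Fin m) (rows : Pairing row) (cols : Pairing col)
  (edge-unique : ∀ {x y} → row x ≡ row y → col x ≡ col y → x ≡ y)
  (edgeAtRow : ∀ i → ∃ λ x → row x ≡ i) (edgeAtCol : ∀ j → ∃ λ x → col x ≡ j) where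

  module R = Pairing rows
  module C = Pairing cols

  σ τ step : E → E
  σ = R.partner
  τ = C.partner
  step x = σ (τ x)

  open Iteration step

  abstract
    edge-≟ : DecidableEquality E
    edge-≟ x y = map′ (λ (r , c) → edge-unique r c) (λ eq → cong row eq , cong col eq)
      ((row x Fin.≟ row y) ×-dec (col x Fin.≟ col y))

    edgeCode-injective : ∀ {x y} → combine (row x) (col x) ≡ combine (row y) (col y) → x ≡ y
    edgeCode-injective {x} {y} eq = let r , c = Fin.combine-injective (row x) (col x) (row y) (col y) eq in edge-unique r c

    step-injective : ∀ {x y} → step x ≡ step y → x ≡ y
    step-injective = C.partner-injective ∘ R.partner-injective

  open Orbits edge-≟ (λ x → combine (row x) (col x)) edgeCode-injective step step-injective

  σ∘step : ∀ x → σ (step x) ≡ τ x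
  σ∘step x = R.involutive (τ x)

  step∘σ∘step : ∀ x → step (σ (step x)) ≡ σ x
  step∘σ∘step x = cong σ (trans (cong τ (σ∘step x)) (C.involutive x))

  -- `σ` conjugates `step` into its inverse, so one step on either side of `σ` cancels, by
  -- `step∘σ∘step`.
  iter-reflect : ∀ k x → iter k (σ (iter k x)) ≡ σ x
  iter-reflect zero    x = refl
  iter-reflect (suc k) x = trans (iter-suc k _) (trans (cong (iter k) (step∘σ∘step (iter k x))) (iter-reflect k x))

  -- If `step` fixed `x`, then `τ x` would share both ends with `x` and equal it, as the graph is
  -- simple. This makes every traversal at least 2 long.
  step≢ : ∀ x → step x ≢ x
  step≢ x eq = C.partner≢ x (edge-unique
    (trans (sym (R.key-partner (τ x))) (cong row eq)) (C.key-partner x))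

  -- With τ = σ ∘ step, each σ ∘ step ^ k is conjugate to σ or to τ in the dihedral group they generate,
  -- and these two have no fixed points: no cycle can be traversed onto itself backwards.
  iter≢σ : ∀ k x → iter k x ≢ σ x
  iter≢σ zero          x eq = R.partner≢ x (sym eq)
  iter≢σ (suc zero)    x eq = C.partner≢ x (R.partner-injective eq)
  iter≢σ (suc (suc k)) x eq = iter≢σ k (step x) (trans (C.partner-injective (R.partner-injective (begin
    step (iter k (step x)) ≡⟨ iter-suc (suc k) x ⟨
    step (step (iter k x)) ≡⟨ eq ⟩
    σ x                    ≡⟨ cong σ (C.involutive x) ⟨
    step (τ x)             ∎))) (sym (σ∘step x)))
    where open ≡-Reasoning

  -- After `b` further steps the right-hand side becomes `σ x`, by `iter-reflect`, and `iter≢σ`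
  -- applies.
  iter≢σ∘iter : ∀ a b x → iter a x ≢ σ (iter b x)
  iter≢σ∘iter a b x eq = iter≢σ (b + a) x
    (trans (iter-+ b a x) (trans (cong (iter b) eq) (iter-reflect b x)))

  reach-σ : ∀ {x y} → Reach x y → Reach (σ x) (σ y)
  reach-σ {x} (k , refl) = reach-sym (k , iter-reflect k x)

  -- The edges x and y lie on a common cycle: they are met when it is traversed in the same direction,
  -- or in opposite directions.
  infix 4 _∼_

  _∼_ : E → E → Set
  x ∼ y = Reach x y ⊎ Reach x (σ y)

  ∼-sym : ∀ {x y} → x ∼ y → y ∼ x
  ∼-sym (inj₁ r) = inj₁ (reach-sym r)
  ∼-sym {x} {y} (inj₂ r) = inj₂ (reach-sym (subst (Reach (σ x)) (R.involutive y) (reach-σ r)))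

  ∼-trans : ∀ {x y z} → x ∼ y → y ∼ z → x ∼ z
  ∼-trans (inj₁ r) (inj₁ s) = inj₁ (reach-trans r s)
  ∼-trans (inj₁ r) (inj₂ s) = inj₂ (reach-trans r s)
  ∼-trans (inj₂ r) (inj₁ s) = inj₂ (reach-trans r (reach-σ s))
  ∼-trans {x} {z = z} (inj₂ r) (inj₂ s) = inj₁ (subst (Reach x) (R.involutive z) (reach-trans r (reach-σ s)))

  components : DecSetoid 0ℓ 0ℓ
  components = record
    { _≈_ = _∼_
    ; isDecEquivalence = record
      { isEquivalence = record { refl = inj₁ (0 , refl) ; sym = ∼-sym ; trans = ∼-trans }
      ; _≟_ = λ x y → reach? x y ⊎-dec reach? x (σ y)
      }
    }

  -- One edge chosen on each cycle. The roots are indexed by the blocks of `lengths`, so that a cell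
  -- names a root and a number of steps from it.
  record ComponentRoots : Set where
    field
      lengths         : List ℕ
      lengths≥2       : All (2 ≤_) lengths
      root            : Fin (length lengths) → E
      root-order      : ∀ i → lookup lengths i ≡ order (root i)
      root-injective  : ∀ {i j} → root i ∼ root j → i ≡ j
      root-surjective : ∀ x → ∃ λ i → root i ∼ x

  -- One edge per CN is enough to enumerate the cycles: any edge shares its CN with a listed edge,
  -- so it is that edge or its `σ`-partner, which lies on the same cycle.
  component-cardinality : ∃ λ n → Bijection (setoid (Fin n)) (DecSetoid.setoid components)
  component-cardinality = enumeration⇒cardinality components {xs = tabulate (proj₁ ∘ edgeAtRow)}
    (λ x → AnyP.tabulate⁺ (row x) (related x (edgeAtRow (row x))))
    where
    related : ∀ x (e : ∃ λ y → row y ≡ row x) → x ∼ proj₁ e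
    related x (y , eq) = [ (λ x≡y → inj₁ (0 , x≡y)) , (λ x≡σy → inj₂ (0 , x≡σy)) ]′ (R.same-key eq)

  componentRoots : ComponentRoots
  componentRoots = fromBijection (proj₂ component-cardinality)
    where
    fromBijection : Bijection (setoid (Fin n)) (DecSetoid.setoid components) → ComponentRoots
    fromBijection φ = record
      { lengths         = tabulate (order ∘ to)
      ; lengths≥2       = AllP.tabulate⁺ (λ i → order≥2 (to i) (step≢ (to i)))
      ; root            = to ∘ cast len
      ; root-order      = lookup-tabulate (order ∘ to)
      ; root-injective  = λ eq → to-injective (Perm.cast-id len) (injective eq)
      ; root-surjective = λ x → let i , eq = strictlySurjective x in
          cast (sym len) i , subst (λ k → to k ∼ x) (sym (Fin.cast-involutive len (sym len) i)) eq
      }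
      where
      open Bijection φ using (to; injective; strictlySurjective)
      len = List.length-tabulate (order ∘ to)

  module Traversal (roots : ComponentRoots) where

    open ComponentRoots roots

    edgeAt : Cell lengths → E
    edgeAt (i , j) = iter (toℕ j) (root i)

    -- At position 0 this is the closing of the cycle, since the size of a block is the order of its
    -- root.
    edgeAt-prev : ∀ x → edgeAt x ≡ step (edgeAt (prevCell x))
    edgeAt-prev (i , j) = iter-prev
      (trans (cong (λ k → iter k (root i)) (root-order i)) (iter-order (root i))) j

    edgeAt-hits : ∀ {i y} → Reach (root i) y → ∃ λ x → edgeAt x ≡ y
    edgeAt-hits {i} r with reach-bounded r
    ... | j , eq = (i , cast (sym (root-order i)) j) ,
      trans (cong (λ k → iter k (root i)) (Fin.toℕ-cast (sym (root-order i)) j)) eq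

    edgeAt-block : ∀ {x y} → edgeAt x ∼ edgeAt y → block x ≡ block y
    edgeAt-block {_ , j} {_ , k} eq = root-injective
      (∼-trans (inj₁ (toℕ j , refl)) (∼-trans eq (∼-sym (inj₁ (toℕ k , refl)))))

    edgeAt-injective : ∀ {x y} → edgeAt x ≡ edgeAt y → x ≡ y
    edgeAt-injective {i , j} {_ , k} eq with refl ← edgeAt-block {i , j} {_ , k} (inj₁ (0 , eq)) =
      cong (i ,_) (Fin.toℕ-injective (iter<order-injective
        (subst (toℕ j <_) (root-order i) (Fin.toℕ<n j))
        (subst (toℕ k <_) (root-order i) (Fin.toℕ<n k)) eq))

    rowAt colAt : Cell lengths → Fin m
    rowAt = row ∘ edgeAt
    colAt = col ∘ edgeAt

    -- Distinct edges at one CN are `σ`-partners. They lie on one cycle, hence in one block, and the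
    -- traversal of that block would meet the cycle in both directions.
    rowAt-injective : ∀ {x y} → rowAt x ≡ rowAt y → x ≡ y
    rowAt-injective {x@(i , j)} {y@(_ , k)} eq with R.same-key eq
    ... | inj₁ y≡x = edgeAt-injective (sym y≡x)
    ... | inj₂ y≡σx with refl ← edgeAt-block {y} {x} (inj₂ (0 , y≡σx)) =
      contradiction y≡σx (iter≢σ∘iter (toℕ k) (toℕ j) (root i))

    colAt-injective : ∀ {x y} → colAt x ≡ colAt y → x ≡ y
    colAt-injective {x@(i , j)} {y@(_ , k)} eq with C.same-key eq
    ... | inj₁ y≡x = edgeAt-injective (sym y≡x)
    -- Writing `τ` as `σ ∘ step` reduces this to the argument for CNs, with one extra step from `x`;
    -- hence `suc (toℕ j)` below.
    ... | inj₂ y≡τx with y≡σ ← trans y≡τx (sym (σ∘step (edgeAt x)))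
      with refl ← edgeAt-block {y} {x} (∼-trans (inj₂ (0 , y≡σ)) (∼-sym (inj₁ (1 , refl)))) =
      contradiction y≡σ (iter≢σ∘iter (toℕ k) (suc (toℕ j)) (root i))

    rowAt-surjective : ∀ i → ∃ λ x → rowAt x ≡ i
    rowAt-surjective i with edgeAtRow i
    ... | e , refl with root-surjective e
    ...   | _ , inj₁ r = map₂ (cong row) (edgeAt-hits r)
    ...   | _ , inj₂ r = map₂ (λ eq → trans (cong row eq) (R.key-partner e)) (edgeAt-hits r)

    colAt-surjective : ∀ j → ∃ λ x → colAt x ≡ j
    colAt-surjective j with edgeAtCol j
    ... | e , refl with root-surjective e
    ...   | _ , inj₁ r = map₂ (cong col) (edgeAt-hits r)
    -- In general `σ e` ends at another VN than `e`, but the edge one step before it is `τ e`, which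
    -- shares the VN of `e`.
    ...   | _ , inj₂ r = map₂ (λ eq → trans (cong col eq) (C.key-partner e))
      (edgeAt-hits (reach-trans r (reach-sym (1 , cong σ (C.involutive e)))))

    rowIndex colIndex : Cell lengths ↔ Fin m
    rowIndex = ⤖⇒↔ (mk⤖ (rowAt-injective , strictlySurjective⇒surjective rowAt-surjective))
    colIndex = ⤖⇒↔ (mk⤖ (colAt-injective , strictlySurjective⇒surjective colAt-surjective))

    cycles : PartitionParts≥2 m
    cycles = record
      { parts    = lengths
      ; parts≥2  = lengths≥2
      -- Each CN belongs to exactly one cell, and there are `sum lengths` cells.
      ; sumParts = Perm.↔⇒≡ (rowIndex ↔-∘ ↔-sym (Cell↔Fin lengths))
      }

    -- The edges at the CN of `x` are `edgeAt x` and its `σ`-partner. The latter is `τ` of the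
    -- preceding edge, so it ends at the VN of `prevCell x`.
    incident⇒consecutive : ∀ e {x y} → row e ≡ rowAt x → col e ≡ colAt y → y ≡ x ⊎ y ≡ prevCell x
    incident⇒consecutive e {x} {y} r c with R.same-key (sym r)
    ... | inj₁ refl = inj₁ (colAt-injective (sym c))
    ... | inj₂ refl = inj₂ (colAt-injective (begin
      colAt y                              ≡⟨ c ⟨
      col (σ (edgeAt x))                   ≡⟨ cong (col ∘ σ) (edgeAt-prev x) ⟩
      col (σ (step (edgeAt (prevCell x)))) ≡⟨ cong col (σ∘step _) ⟩
      col (τ (edgeAt (prevCell x)))        ≡⟨ C.key-partner _ ⟩
      colAt (prevCell x)                   ∎))
      where open ≡-Reasoning

    consecutive⇒incident : ∀ {x y} → y ≡ x ⊎ y ≡ prevCell x → ∃ λ e → row e ≡ rowAt x × col e ≡ colAt y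
    consecutive⇒incident {x} (inj₁ refl) = edgeAt x , refl , refl
    -- `τ` keeps the VN of the preceding edge, and applying `σ` next, which keeps the CN, gives
    -- `edgeAt x`.
    consecutive⇒incident {x} (inj₂ refl) = τ (edgeAt (prevCell x)) ,
      trans (sym (R.key-partner _)) (cong row (sym (edgeAt-prev x))) , C.key-partner _

    decomposition : Decomposition row col
    decomposition = record
      { cycles               = cycles
      ; rowIndex             = rowIndex
      ; colIndex             = colIndex
      ; incident⇒consecutive = incident⇒consecutive
      ; consecutive⇒incident = consecutive⇒incident
      }

-- Edges of a 2-regular graph and its decomposition into cycles

module TwoRegular (G : RegularBipartiteGraph m 2) where

  record Edge : Set where
    constructor mkEdge
    field
      row col  : Fin m
      incident : edge G row col ≡ true

  open Edge

  -- The incidence proof is an equation between Booleans, and such proofs are unique.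
  edge-unique : ∀ {x y} → row x ≡ row y → col x ≡ col y → x ≡ y
  edge-unique {mkEdge i j e} {mkEdge _ _ e′} refl refl = cong (mkEdge i j) (Decidable⇒UIP.≡-irrelevant Bool._≟_ e e′)

  rows : Pairing row
  rows = record
    { partner     = λ x → mkEdge (row x) (proj₁ (other x)) (∈-tabulate⁻ (proj₁ (proj₂ (other x))))
    ; key-partner = λ _ → refl
    ; partner≢    = λ x eq → proj₁ (proj₂ (proj₂ (other x))) (cong col eq)
    ; same-key    = λ { {x} {mkEdge _ _ e} refl →
        Sum.map (edge-unique refl) (edge-unique refl) (proj₂ (proj₂ (proj₂ (other x))) (∈-tabulate⁺ e)) }
    }
    where
    other = λ x → ∣p∣≡2⇒partner (degreeCN G (row x)) (∈-tabulate⁺ (incident x))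

  cols : Pairing col
  cols = record
    { partner     = λ x → mkEdge (proj₁ (other x)) (col x) (∈-tabulate⁻ (proj₁ (proj₂ (other x))))
    ; key-partner = λ _ → refl
    ; partner≢    = λ x eq → proj₁ (proj₂ (proj₂ (other x))) (cong row eq)
    ; same-key    = λ { {x} {mkEdge _ _ e} refl →
        Sum.map (λ r → edge-unique r refl) (λ r → edge-unique r refl)
          (proj₂ (proj₂ (proj₂ (other x))) (∈-tabulate⁺ e)) }
    }
    where
    other = λ x → ∣p∣≡2⇒partner (degreeVN G (col x)) (∈-tabulate⁺ (incident x))

  edgeAtRow : ∀ i → ∃ λ x → row x ≡ i
  edgeAtRow i with j , j∈ ← ∣p∣≡1+k⇒Nonempty (degreeCN G i) = mkEdge i j (∈-tabulate⁻ j∈) , refl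

  edgeAtCol : ∀ j → ∃ λ x → col x ≡ j
  edgeAtCol j with i , i∈ ← ∣p∣≡1+k⇒Nonempty (degreeVN G j) = mkEdge i j (∈-tabulate⁻ i∈) , refl

  module _ (decomposition : Decomposition row col) where
    open Decomposition decomposition

    private
      cell : Cell (parts cycles) ↔ Fin m
      cell = cellIndex cycles

      π = cyclePermutation cycles
      π≢ = cyclePermutation≢ cycles

      ρ κ : Permutation′ m
      ρ = rowIndex ↔-∘ ↔-sym cell
      κ = colIndex ↔-∘ ↔-sym cell

    edge⇒adjacent : ∀ i j → edge G (ρ ⟨$⟩ʳ i) (κ ⟨$⟩ʳ j) ≡ true → j ≡ i ⊎ j ≡ π ⟨$⟩ʳ i
    edge⇒adjacent i j e = Sum.map (to-injective (↔-sym cell))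
      (λ eq → trans (sym (to-from cell j)) (cong (Inverse.to cell) eq))
      (incident⇒consecutive (mkEdge _ _ e) refl refl)

    adjacent⇒edge : ∀ i j → j ≡ i ⊎ j ≡ π ⟨$⟩ʳ i → edge G (ρ ⟨$⟩ʳ i) (κ ⟨$⟩ʳ j) ≡ true
    adjacent⇒edge i j adj with consecutive⇒incident
      (Sum.map (cong (Inverse.from cell)) (λ eq → trans (cong (Inverse.from cell) eq) (from-to cell _)) adj)
    ... | mkEdge _ _ e , refl , refl = e

    -- `ρ` and `κ` send the CN and the VN of a cell in `cycleGraph` to those of the same cell in
    -- `G`, so the two halves of the decomposition compare the entries.
    G≅cycleGraph : biadjacency G ≅ biadjacency (cycleGraph cycles)
    G≅cycleGraph = ρ , κ , λ i j →
      trans (entry-biadjacency G _ _)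
      (trans (bool-ext (adjacent⁺ π π≢ i j ∘ edge⇒adjacent i j) (adjacent⇒edge i j ∘ adjacent⁻ π π≢ i j))
      (sym (entry-biadjacency (cycleGraph cycles) i j)))

  isomorphicToCycleGraph : ∃ λ P → biadjacency G ≅ biadjacency (cycleGraph P)
  isomorphicToCycleGraph = Decomposition.cycles decomposition , G≅cycleGraph decomposition
    where
    open CycleDecomposition row col rows cols edge-unique edgeAtRow edgeAtCol
    decomposition : Decomposition row col
    decomposition = Traversal.decomposition componentRoots

-- The bijection between partitions and isomorphism classes

P₂⤖IsoClasses : ∀ m → Bijection (P₂ m) (IsoClasses m 2)
P₂⤖IsoClasses m = record
  { to        = cycleGraph
  ; cong      = λ {P} {Q} P↭Q → ≅⇒⟶* (↭⇒≅ P Q P↭Q)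
  ; bijective = (λ {P} {Q} iso → ≅⇒↭ P Q (≅-sym (biadjacency (cycleGraph P)) (biadjacency (cycleGraph Q)) (⟶*⇒≅ iso)))
              , λ G → let P , G≅P = TwoRegular.isomorphicToCycleGraph G in
                  -- Surjectivity between setoids concerns every `Q` equal to `P`, so the path to
                  -- `G` goes through the cycle graph of `P`.
                  P , λ {Q} Q↭P → Setoid.trans (IsoClasses m 2) {cycleGraph Q} {cycleGraph P} {G} (≅⇒⟶* (↭⇒≅ Q P Q↭P))
                        (≅⇒⟶* (≅-sym (biadjacency G) (biadjacency (cycleGraph P)) G≅P))
  }

-- Counting partitions

open Sort ℕ.≤-decTotalOrder using (sort; sort-↭; sort-↗)

-- Sorting yields a canonical representative of each rearrangement class, which reduces the question
-- to equality of lists.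
_↭?_ : (p q : List ℕ) → Dec (p ↭ q)
p ↭? q = map′
  (λ eq → ↭-trans (↭-sym (sort-↭ p)) (↭-trans (↭-reflexive eq) (sort-↭ q)))
  (λ p↭q → Pointwise-≡⇒≡ (↗↭↗⇒≋ ℕ.≤-totalOrder (sort-↗ p) (sort-↗ q)
    (↭⇒↭ₛ (↭-trans (sort-↭ p) (↭-trans p↭q (↭-sym (sort-↭ q)))))))
  (List.≡-dec ℕ._≟_ (sort p) (sort q))

P₂-decSetoid : ℕ → DecSetoid 0ℓ 0ℓ
P₂-decSetoid m = record
  { isDecEquivalence = record
    { isEquivalence = Setoid.isEquivalence (P₂ m)
    ; _≟_           = λ P Q → parts P ↭? parts Q
    }
  }

listsUpTo : List ℕ → ℕ → List (List ℕ)
listsUpTo xs zero    = [] ∷ []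
listsUpTo xs (suc n) = [] ∷ cartesianProductWith _∷_ xs (listsUpTo xs n)

∈-listsUpTo : ∀ {xs p n} → All (_∈ₗ xs) p → length p ≤ n → p ∈ₗ listsUpTo xs n
∈-listsUpTo {n = zero}  []         _         = here refl
∈-listsUpTo {n = suc n} []         _         = here refl
∈-listsUpTo {n = suc n} (x∈ ∷ p∈) (s≤s len) = there (∈-cartesianProductWith⁺ _∷_ x∈ (∈-listsUpTo p∈ len))

parts≤sum : ∀ p → All (_≤ sum p) p
parts≤sum []      = []
parts≤sum (k ∷ p) = ℕ.m≤m+n k (sum p) ∷ All.map (λ le → ℕ.≤-trans le (ℕ.m≤n+m (sum p) k)) (parts≤sum p)

length≤sum : ∀ {p} → All (2 ≤_) p → length p ≤ sum p
length≤sum []          = z≤n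
length≤sum (2≤k ∷ p≥2) = ℕ.+-mono-≤ (ℕ.≤-trans (s≤s z≤n) 2≤k) (length≤sum p≥2)

partition? : ∀ m p → Dec (All (2 ≤_) p × sum p ≡ m)
partition? m p = all? (2 ℕ.≤?_) p ×-dec sum p ℕ.≟ m

withParts : ∀ m → List ℕ → List (PartitionParts≥2 m)
withParts m p with partition? m p
... | yes (p≥2 , sum≡m) = record { parts = p ; parts≥2 = p≥2 ; sumParts = sum≡m } ∷ []
... | no _              = []

∈-withParts : (P : PartitionParts≥2 m) → Any (λ Q → parts P ↭ parts Q) (withParts m (parts P))
∈-withParts {m} P with partition? m (parts P)
... | yes _ = here ↭-refl
... | no ¬p = contradiction (parts≥2 P , sumParts P) ¬p

-- A partition of `m` has parts at most `m`, and at most `m` of them, so a finite search finds it.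
-- Its rearrangements are listed too and are merged when classes are counted.
partitions : ∀ m → List (PartitionParts≥2 m)
partitions m = concatMap (withParts m) (listsUpTo (upTo (suc m)) m)

∈-partitions : (P : PartitionParts≥2 m) → Any (λ Q → parts P ↭ parts Q) (partitions m)
∈-partitions {m} P = AnyP.concatMap⁺ (withParts m) (Any.map (λ { refl → ∈-withParts P })
  (∈-listsUpTo
    (All.map (λ k≤ → ∈-upTo⁺ (s≤s (subst (_ ≤_) (sumParts P) k≤))) (parts≤sum (parts P)))
    (subst (length (parts P) ≤_) (sumParts P) (length≤sum (parts≥2 P)))))

partitionCount : ∀ m → ∃ λ n → HasCardinality (P₂ m) n
partitionCount m = enumeration⇒cardinality (P₂-decSetoid m) ∈-partitions

theorem16 : (m : ℕ) → 2 < m →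
    Bijection (P₂ m) (IsoClasses m 2) ×
    (∃[ n ] (E[ m , 2 ]≔ n × p[ m ,2]≔ n))
-- The enumeration of `P₂ m`, composed with the bijection, counts the isomorphism classes by the
-- same number.
theorem16 m _ = P₂⤖IsoClasses m , proj₁ count , bijection (proj₂ count) (P₂⤖IsoClasses m) , proj₂ count
  where
  count = partitionCount m
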